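{- Let $\lambda$ be an infinite cardinal satisfying the following two conditions: (A1) $\mathrm{cof}(\lambda)>\aleph_0$ or $\lambda>2^{\aleph_0}$; (A2) there is a family $\mathcal{A}\subseteq\mathcal{P}(\lambda)$ of cardinality $2^\lambda$ such that $|\{A\cap i: A\in\mathcal{A}\}|\le\lambda$ for all $i<\lambda$. Then there is a regular but not doubly regular filter on $\lambda$.
   Context: A family of sets is a regular family if finite intersections of members of the family are non-empty but all infinite intersections (i.e. intersections of infinitely many members) are empty. A filter is $\mu$-regular if it contains a regular family of size $\mu$. A filter on $\lambda$, or on a set of cardinality $\lambda$, is called regular if it is $\lambda$-regular. A filter $D$ on $\lambda$ is called doubly regular if there are pairwise disjoint sets $u_i\subseteq\lambda$, $i<\lambda$, each of cardinality $\lambda$, and regular filters $D_i$ on $u_i$, such that for all $A\subseteq\lambda$: if $A\cap u_i\in D_i$ for all but boundedly many $i<\lambda$, then $A\in D$. $\mathcal{P}(\lambda)$ is the power set of $\lambda$; an ordinal $i<\lambda$ is identified with the set of smaller ordinals. -}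

module Defs where

open import Axiom.ExcludedMiddle using (ExcludedMiddle)
open import Data.Bool.Base using (Bool; true; false; T; _∧_)
open import Data.List.Base using (List)
open import Data.List.Relation.Unary.All using (All)
open import Data.Nat.Base using (ℕ)
open import Data.Product.Base using (Σ-syntax; ∃-syntax; _×_; proj₁)
open import Function.Base using (_∘_)
open import Function.Bundles using (_↣_; _⤖_)
open import Induction.WellFounded using (WellFounded)
open import Level using (Level; _⊔_; suc)
open import Relation.Binary.Core using (Rel)
open import Relation.Binary.PropositionalEquality.Core using (_≡_; _≢_)
open import Relation.Binary.Structures using (IsStrictTotalOrder)
open import Relation.Nullary using (¬_)
open import Relation.Nullary.Decidable.Core using (does)

private
  variable
    a b : Level

------------------------------------------------------------------------
-- Subsets

-- Everything here is meant to be read in the presence of excluded middle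
-- and function extensionality. Then every predicate is Bool-valued,
-- extensionally equal subsets are propositionally equal, and X → Bool is
-- the power set of X, in the same universe as X.

𝒫 : Set a → Set a
𝒫 X = X → Bool

infix 4 _∈_ _∉_ _⊆_
infixr 7 _∩_

_∈_ _∉_ : {X : Set a} → X → 𝒫 X → Set
x ∈ A = T (A x)
x ∉ A = ¬ (x ∈ A)

_⊆_ : {X : Set a} → 𝒫 X → 𝒫 X → Set a
A ⊆ B = ∀ {x} → x ∈ A → x ∈ B

_∩_ : {X : Set a} → 𝒫 X → 𝒫 X → 𝒫 X
(A ∩ B) x = A x ∧ B x

∅ full : {X : Set a} → 𝒫 X
∅ _ = false
full _ = true

-- Membership proofs are unique, so that cardinalities of El A are
-- cardinalities of A.

El : {X : Set a} → 𝒫 X → Set a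
El {X = X} A = Σ[ x ∈ X ] x ∈ A

-- A ∩ u, as a subset of the set u.

_∣_ : {X : Set a} → 𝒫 X → (u : 𝒫 X) → 𝒫 (El u)
A ∣ u = A ∘ proj₁

-- { f x : x ∈ A }

image : {X Y : Set a} → ExcludedMiddle a → (X → Y) → 𝒫 X → 𝒫 Y
image em f A y = does (em {P = ∃[ x ] x ∈ A × f x ≡ y})

------------------------------------------------------------------------
-- Cardinalities

infix 4 _≺_

_≺_ : Set a → Set b → Set (a ⊔ b)
X ≺ Y = (X ↣ Y) × ¬ (Y ↣ X)

Infinite : Set a → Set a
Infinite X = ℕ ↣ X

-- An infinite cardinal, as an initial ordinal: an infinite well-ordered
-- set, none of whose proper initial segments has full cardinality.

record InfiniteCardinal ℓ : Set (suc ℓ) where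
  infix 4 _<_
  field
    Carrier            : Set ℓ
    _<_                : Rel Carrier ℓ
    isStrictTotalOrder : IsStrictTotalOrder _≡_ _<_
    wellFounded        : WellFounded _<_

  open IsStrictTotalOrder isStrictTotalOrder public using (_<?_)

  -- The ordinal i, as the set of smaller ordinals.

  ↓ : Carrier → 𝒫 Carrier
  ↓ i j = does (j <? i)

  field
    initial  : ∀ i → El (↓ i) ≺ Carrier
    infinite : Infinite Carrier

  Bounded : 𝒫 Carrier → Set ℓ
  Bounded S = ∃[ j ] ∀ i → i ∈ S → i < j

  Unbounded : 𝒫 Carrier → Set ℓ
  Unbounded S = ¬ Bounded S

  -- The cofinality is the cardinality of C: it is the least cardinality
  -- of an unbounded subset, and it is attained at C.

  AttainsCofinality : 𝒫 Carrier → Set ℓ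
  AttainsCofinality C = Unbounded C × (∀ S → Unbounded S → El C ↣ El S)

  UncountableCofinality : Set ℓ
  UncountableCofinality = ∃[ C ] AttainsCofinality C × ℕ ≺ El C

------------------------------------------------------------------------
-- Filters

-- Filters are proper.

record Filter (X : Set a) : Set a where
  field
    sets     : 𝒫 (𝒫 X)
    full∈    : full ∈ sets
    ∅∉       : ∅ ∉ sets
    ∩-closed : ∀ {A B} → A ∈ sets → B ∈ sets → A ∩ B ∈ sets
    ⊆-closed : ∀ {A B} → A ∈ sets → A ⊆ B → B ∈ sets

open Filter public using (sets)

RegularFamily : {X : Set a} → 𝒫 (𝒫 X) → Set a
RegularFamily {X = X} E =
  ((As : List (𝒫 X)) → All (_∈ E) As → ∃[ x ] All (x ∈_) As) ×
  (∀ S → S ⊆ E → Infinite (El S) → ¬ (∃[ x ] ∀ A → A ∈ S → x ∈ A))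

-- μ-regularity, where μ is the cardinality of M.

Regular : {X : Set a} → Set b → Filter X → Set (a ⊔ b)
Regular M D = ∃[ E ] E ⊆ sets D × RegularFamily E × (El E ⤖ M)

record DoublyRegular {ℓ} (κ : InfiniteCardinal ℓ)
  (D : Filter (InfiniteCardinal.Carrier κ)) : Set ℓ where
  open InfiniteCardinal κ using (Carrier; Bounded)
  field
    u         : Carrier → 𝒫 Carrier
    disjoint  : ∀ i j → i ≢ j → ∀ x → ¬ (x ∈ u i × x ∈ u j)
    size      : ∀ i → El (u i) ⤖ Carrier
    F         : ∀ i → Filter (El (u i))
    F-regular : ∀ i → Regular Carrier (F i)
    contains  : ∀ A →
      (∃[ S ] Bounded S × (∀ i → i ∉ S → (A ∣ u i) ∈ sets (F i))) →
      A ∈ sets D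

{-# OPTIONS --safe #-}

-- Since |[λ]^{<ω}| = λ, index the points by the finite subsets of λ. The sets
-- of points x with a ∈ x, for a < λ, are a regular family. Let D be the filter
-- it generates; D has a basis of λ sets.
--
-- Suppose that D is doubly regular via uᵢ and Dᵢ, and let E i be a regular
-- family in Dᵢ, indexed by λ. By (A2), A ∩ i is coded by an index below λ, for
-- each A ∈ 𝒜. The union over i of the member of E i at the code of A ∩ i (with
-- all points outside the uᵢ) is in D, so it includes a basic set. It suffices
-- to see that at most λ many A share a basic set G, since then 2^λ ≤ λ. The
-- set G meets uᵢ for unboundedly many i, as otherwise its complement is in D.
-- For such i, a point of G ∩ uᵢ lies in only finitely many members of E i, so
-- that these A have finitely many traces A ∩ i. If cof(λ) > ℵ₀, this leaves
-- finitely many A, because ℵ₀ many could be told apart below a single i.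
-- Otherwise λ > 2^ℵ₀, and A is determined by its traces along a cofinal
-- ω-sequence of such i, which leaves at most ℵ₀^ℵ₀ ≤ λ many.

module Submission where

open import Defs
open import Level using (Level)
open import Axiom.ExcludedMiddle using (ExcludedMiddle)
open import Axiom.Extensionality.Propositional using (Extensionality; lower-extensionality)
open import Data.Bool.Base using (T; _∧_)
open import Data.Bool.Properties using (T-irrelevant; T-∧; T?; ∧-identityʳ; _≟_)
open import Data.Empty using (⊥)
open import Data.Fin.Base using (toℕ)
open import Data.Fin.Properties using (pigeonhole; toℕ-injective) renaming (<⇒≢ to <⇒≢-Fin)
open import Data.List.Base using (List; []; _∷_; _++_; length; lookup; map; cartesianProduct)
open import Data.List.Membership.Propositional using () renaming (_∈_ to _∈ₗ_; _∉_ to _∉ₗ_)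
open import Data.List.Membership.Propositional.Properties using (∈-cartesianProduct⁺; ∈-map⁺; ∈-++⁺ˡ; ∈-++⁺ʳ)
open import Data.List.Relation.Unary.All using (All; []; _∷_)
open import Data.List.Relation.Unary.Any using (here; there; index)
open import Data.List.Relation.Unary.Any.Properties using (lookup-index)
open import Data.Maybe.Base using (Maybe; just; nothing)
open import Data.Maybe.Properties using (just-injective)
open import Data.Nat.Base using (ℕ; zero; suc; _+_; _≡ᵇ_) renaming (_<_ to _<ℕ_)
open import Data.Nat.Properties using (+-suc; ≡ᵇ⇒≡; ≡⇒≡ᵇ; ≤-pred; <⇒≱; n<1+n; +-identityʳ)
  renaming (<-cmp to <-cmpℕ; _≟_ to _≟ℕ_)
open import Data.Product.Base using (Σ-syntax; ∃-syntax; _×_; _,_; proj₁; proj₂)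
open import Data.Product.Properties using (,-injectiveˡ; ,-injectiveʳ)
open import Data.Product.Relation.Binary.Lex.Strict using (×-Lex; ×-wellFounded)
open import Data.Sum.Base using (_⊎_; inj₁; inj₂)
open import Function.Base using (_∘_; id)
open import Function.Bundles using (_↣_; _⤖_; mk↣; mk⤖; mk⇔; Injection; Equivalence)
open import Function.Construct.Composition using (_↣-∘_)
open import Function.Construct.Identity using (↣-id)
open import Function.Properties.Bijection using (⤖⇒↔)
open import Function.Properties.Inverse using (↔⇒↣; ↔-sym)
open import Induction.WellFounded using (WellFounded; module All; module FixPoint)
open import Relation.Binary.Construct.On as On using ()
open import Relation.Binary.Definitions using (Tri; tri<; tri≈; tri>)
open import Relation.Binary.PropositionalEquality
  using (_≡_; _≢_; refl; sym; trans; cong; cong₂; cong-app; subst)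
open import Relation.Binary.Structures using (IsStrictTotalOrder)
open import Relation.Nullary using (¬_; Dec; yes; no; does; contradiction)
open import Relation.Nullary.Decidable using (decidable-stable; dec-true; does-⇔)

open Injection using (to; injective)

private
  variable
    a b ℓ : Level

-- Finite and countable types

no-injection-into-list : {X : Set a} (f : ℕ ↣ X) (xs : List X) → ¬ (∀ n → to f n ∈ₗ xs)
no-injection-into-list f xs f∈xs
  with i , j , i<j , eq ← pigeonhole (n<1+n (length xs)) (λ i → index (f∈xs (toℕ i)))
  = <⇒≢-Fin i<j (toℕ-injective (injective f
      (trans (lookup-index (f∈xs (toℕ i)))
        (trans (cong (lookup xs) eq) (sym (lookup-index (f∈xs (toℕ j))))))))

Listable : Set a → Set a
Listable X = ∃[ xs ] ∀ (x : X) → x ∈ₗ xs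

listable⇒↣ℕ : {X : Set a} → Listable X → X ↣ ℕ
listable⇒↣ℕ (xs , x∈xs) = mk↣ {to = λ x → toℕ (index (x∈xs x))} λ {x} {y} eq →
  trans (lookup-index (x∈xs x))
    (trans (cong (lookup xs) (toℕ-injective eq)) (sym (lookup-index (x∈xs y))))

module _ {X : Set a} (fresh : (xs : List X) → ∃[ x ] x ∉ₗ xs) where

  private
    prefix : ℕ → List X
    prefix zero    = []
    prefix (suc n) = proj₁ (fresh (prefix n)) ∷ prefix n

    f : ℕ → X
    f n = proj₁ (fresh (prefix n))

    earlier : ∀ {m n} → m <ℕ n → f m ∈ₗ prefix n
    earlier {m} {suc n} m<1+n with <-cmpℕ m n
    ... | tri< m<n _ _  = there (earlier m<n)
    ... | tri≈ _ refl _ = here refl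
    ... | tri> _ _ n<m  = contradiction (≤-pred m<1+n) (<⇒≱ n<m)

    later : ∀ {m n} → m <ℕ n → f m ≢ f n
    later {n = n} m<n eq = proj₂ (fresh (prefix n)) (subst (_∈ₗ prefix n) eq (earlier m<n))

  -- Each value is chosen outside the list of all earlier values.
  fresh⇒infinite : Infinite X
  fresh⇒infinite = mk↣ {to = f} f-injective
    where
    f-injective : ∀ {m n} → f m ≡ f n → m ≡ n
    f-injective {m} {n} eq with <-cmpℕ m n
    ... | tri< m<n _ _ = contradiction eq (later m<n)
    ... | tri≈ _ m≡n _ = m≡n
    ... | tri> _ _ n<m = contradiction (sym eq) (later n<m)

-- Cantor's enumeration of pairs, one antidiagonal after another.
unpair : ℕ → ℕ × ℕ
unpair zero = 0 , 0
unpair (suc z) with unpair z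
... | zero  , y = suc y , 0
... | suc x , y = x , suc y

-- The recursion runs backwards along the antidiagonals x + y ≡ s.

unpair-surjective : ∀ s y x → x + y ≡ s → ∃[ z ] unpair z ≡ (x , y)
unpair-surjective s (suc y) x eq
  with z , eq′ ← unpair-surjective s y (suc x) (trans (sym (+-suc x y)) eq)
  = suc z , lemma
  where
  lemma : unpair (suc z) ≡ (x , suc y)
  lemma rewrite eq′ = refl
unpair-surjective zero zero zero eq = 0 , refl
unpair-surjective (suc s) zero (suc x) eq
  with z , eq′ ← unpair-surjective s s 0 refl
  = suc z , lemma
  where
  lemma : unpair (suc z) ≡ (suc x , 0)
  lemma rewrite eq′ | +-identityʳ x = cong (_, 0) (sym eq)

-- This gives ℵ₀^ℵ₀ ≤ 2^ℵ₀: a sequence of trace indices becomes one subset of ℕ.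
graph : (ℕ → ℕ) → 𝒫 ℕ
graph g z = g (proj₁ (unpair z)) ≡ᵇ proj₂ (unpair z)

graph-injective : ∀ g h → graph g ≡ graph h → ∀ n → g n ≡ h n
-- Here `z` codes the point `(n , g n)` of the first graph, so it lies in the second.
graph-injective g h eq n with z , eq′ ← unpair-surjective _ (g n) n refl =
  sym (≡ᵇ⇒≡ (h n) (g n)
    (subst (λ p → T (h (proj₁ p) ≡ᵇ proj₂ p)) eq′
      (subst T (cong-app eq z)
        (subst (λ p → T (g (proj₁ p) ≡ᵇ proj₂ p)) (sym eq′) (≡⇒≡ᵇ (g n) (g n) refl)))))

-- Pairing functions

record Distinct (X : Set a) : Set a where
  field
    {x₀ x₁} : X
    x₀≢x₁   : x₀ ≢ x₁

infinite⇒distinct : {X : Set a} → Infinite X → Distinct X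
infinite⇒distinct f = record
  { x₀≢x₁ = λ eq → contradiction (injective f {0} {1} eq) λ () }

module _ {X : Set a} (d : Distinct X) (pair : (X × X) ↣ X) where
  open Distinct d

  -- The first coordinate is a tag that tells `nothing` from `just`.
  Maybe↣ : Maybe X ↣ X
  Maybe↣ = mk↣ {to = to pair ∘ f} (f-injective ∘ injective pair)
    where
    f : Maybe X → X × X
    f nothing  = x₀ , x₀
    f (just x) = x₁ , x

    f-injective : ∀ {m n} → f m ≡ f n → m ≡ n
    f-injective {nothing} {nothing} eq = refl
    f-injective {nothing} {just _}  eq = contradiction (,-injectiveˡ eq) x₀≢x₁
    f-injective {just _}  {nothing} eq = contradiction (sym (,-injectiveˡ eq)) x₀≢x₁
    f-injective {just _}  {just _}  eq = cong just (,-injectiveʳ eq)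

  List↣ : List X ↣ X
  List↣ = mk↣ {to = code} λ {xs} {ys} → code-injective xs ys
    where
    code : List X → X
    code []       = to Maybe↣ nothing
    code (x ∷ xs) = to Maybe↣ (just (to pair (x , code xs)))

    code-injective : ∀ xs ys → code xs ≡ code ys → xs ≡ ys
    code-injective [] [] eq = refl
    code-injective [] (y ∷ ys) eq = contradiction (injective Maybe↣ {nothing} {just _} eq) λ ()
    code-injective (x ∷ xs) [] eq = contradiction (injective Maybe↣ {just _} {nothing} eq) λ ()
    code-injective (x ∷ xs) (y ∷ ys) eq =
      let eq′ = injective pair (just-injective (injective Maybe↣ {just _} {just _} eq)) in
      cong₂ _∷_ (,-injectiveˡ eq′) (code-injective xs ys (,-injectiveʳ eq′))

×-map↣ : {X Y : Set a} {Z W : Set b} → X ↣ Z → Y ↣ W → (X × Y) ↣ (Z × W)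
×-map↣ f g = mk↣ {to = λ (x , y) → to f x , to g y} λ eq →
  cong₂ _,_ (injective f (,-injectiveˡ eq)) (injective g (,-injectiveʳ eq))

El-≡ : {X : Set a} {A : 𝒫 X} {p q : El A} → proj₁ p ≡ proj₁ q → p ≡ q
El-≡ refl = cong (_ ,_) (T-irrelevant _ _)

does⁻ : {P : Set a} (d : Dec P) → T (does d) → P
does⁻ (yes p) _ = p

does⁺ : {P : Set a} (d : Dec P) → P → T (does d)
does⁺ (yes _) _ = _
does⁺ (no ¬p) p = ¬p p

-- Classical logic and power sets

module Classical {ℓ} (em : ExcludedMiddle ℓ) (ext : Extensionality ℓ ℓ) where

  dne : {P : Set ℓ} → ¬ ¬ P → P
  dne = decidable-stable em

  ¬∀⇒∃¬ : {X : Set ℓ} {P : X → Set ℓ} → ¬ (∀ x → P x) → ∃[ x ] ¬ P x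
  ¬∀⇒∃¬ ¬∀ = dne λ ¬∃ → ¬∀ λ x → dne λ ¬p → ¬∃ (x , ¬p)

  setOf : {X : Set ℓ} → (X → Set ℓ) → 𝒫 X
  setOf P x = does (em {P = P x})

  ∈⁻ : {X : Set ℓ} (P : X → Set ℓ) {x : X} → x ∈ setOf P → P x
  ∈⁻ P = does⁻ em

  ∈⁺ : {X : Set ℓ} (P : X → Set ℓ) {x : X} → P x → x ∈ setOf P
  ∈⁺ P = does⁺ em

  𝒫-ext : {X : Set ℓ} {A B : 𝒫 X} → (∀ x → A x ≡ B x) → A ≡ B
  𝒫-ext = lower-extensionality ℓ ℓ ext

  separate : {X : Set ℓ} {A B : 𝒫 X} → A ≢ B → ∃[ x ] A x ≢ B x
  separate A≢B = dne λ none → A≢B (𝒫-ext λ x →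
    decidable-stable (_ ≟ _) λ ≢ → none (x , ≢))

  -- The diagonal set `D` collects the values of `f` at sets that omit their own value. By
  -- injectivity `to f D` is outside `D`, which puts it into `D`.
  cantor : {X : Set ℓ} → ¬ (𝒫 X ↣ X)
  cantor {X} f = x∉D (∈⁺ P (D , refl , x∉D))
    where
    P : X → Set ℓ
    P x = ∃[ A ] to f A ≡ x × x ∉ A

    D : 𝒫 X
    D = setOf P

    x∉D : to f D ∉ D
    x∉D x∈D with A , eq , x∉A ← ∈⁻ P x∈D = x∉A (subst (to f D ∈_) (sym (injective f eq)) x∈D)

  finite⇒listable : {X : Set ℓ} → ¬ Infinite X → Listable X
  finite⇒listable fin = dne λ ¬listable →
    fin (fresh⇒infinite λ xs → ¬∀⇒∃¬ λ x∈xs → ¬listable (xs , x∈xs))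

  module Cardinal (κ : InfiniteCardinal ℓ) where
    open InfiniteCardinal κ renaming (Carrier to K)
    open IsStrictTotalOrder isStrictTotalOrder using (compare; irrefl) renaming (trans to <-trans)

    -- Order and initial segments of a cardinal

    ∈↓⁻ : ∀ {k x} → x ∈ ↓ k → x < k
    ∈↓⁻ {k} {x} = does⁻ (x <? k)

    ∈↓⁺ : ∀ {k x} → x < k → x ∈ ↓ k
    ∈↓⁺ {k} {x} = does⁺ (x <? k)

    Segment : K → Set ℓ
    Segment k = El (↓ k)

    ≮-trans : ∀ {x y z} → ¬ y < x → ¬ z < y → ¬ z < x
    ≮-trans {x} {y} y≮x z≮y z<x with compare x y
    ... | tri< x<y _ _  = z≮y (<-trans z<x x<y)
    ... | tri≈ _ refl _ = z≮y z<x
    ... | tri> _ _ y<x  = y≮x y<x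

    ≮-<-trans : ∀ {x y z} → ¬ y < x → y < z → x < z
    ≮-<-trans {x} {y} y≮x y<z with compare x y
    ... | tri< x<y _ _  = <-trans x<y y<z
    ... | tri≈ _ refl _ = y<z
    ... | tri> _ _ y<x  = contradiction y<x y≮x

    Segment-mono : ∀ {j k} → j < k → Segment j ↣ Segment k
    Segment-mono {j} {k} j<k =
      mk↣ {to = λ (x , x<j) → x , ∈↓⁺ (<-trans (∈↓⁻ x<j) j<k)} λ eq → El-≡ (cong proj₁ eq)

    -- `Maybe (Segment k)` stands for the points up to and including `k`, with `nothing` for `k`
    -- itself.
    classify : ∀ {k x} → Tri (x < k) (x ≡ k) (k < x) → ¬ k < x → Maybe (Segment k)
    classify {x = x} (tri< x<k _ _) k≮x = just (x , ∈↓⁺ x<k)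
    classify         (tri≈ _ _ _)   k≮x = nothing
    classify         (tri> _ _ k<x) k≮x = contradiction k<x k≮x

    classify-injective : ∀ {k x y} (t : Tri (x < k) (x ≡ k) (k < x)) (u : Tri (y < k) (y ≡ k) (k < y)) →
      ∀ p q → classify t p ≡ classify u q → x ≡ y
    classify-injective (tri< _ _ _)   (tri< _ _ _)   p q eq = cong proj₁ (just-injective eq)
    classify-injective (tri≈ _ x≡k _) (tri≈ _ y≡k _) p q eq = trans x≡k (sym y≡k)
    classify-injective (tri> _ _ k<x) _              p q eq = contradiction k<x p
    classify-injective _              (tri> _ _ k<y) p q eq = contradiction k<y q

    closedSegment : ∀ k x → ¬ k < x → Maybe (Segment k)
    closedSegment k x = classify (compare x k)

    closedSegment-injective : ∀ k {x y} p q →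
      closedSegment k x p ≡ closedSegment k y q → x ≡ y
    closedSegment-injective k = classify-injective (compare _ k) (compare _ k)

    ClosedSquare : K → Set ℓ
    ClosedSquare k = Maybe (Segment k) × Maybe (Segment k)

    -- Hessenberg's theorem that |λ × λ| = λ. The map g sends each pair to a
    -- value not taken at any smaller pair, in the order by maximum, then
    -- lexicographically. The pairs below p lie in a square with side at most
    -- max p, so such a value exists.

    module GödelOrder {X : Set ℓ} (v : X ↣ K) (inf : Infinite X)
      (small : ∀ m → ¬ (X ↣ ClosedSquare (to v m))) where

      max : X × X → X
      max (x , y) with to v x <? to v y
      ... | yes _ = y
      ... | no  _ = x

      ≤maxˡ : ∀ p → ¬ to v (max p) < to v (proj₁ p)
      ≤maxˡ (x , y) with to v x <? to v y
      ... | yes x<y = λ y<x → irrefl refl (<-trans x<y y<x)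
      ... | no  _   = irrefl refl

      ≤maxʳ : ∀ p → ¬ to v (max p) < to v (proj₂ p)
      ≤maxʳ (x , y) with to v x <? to v y
      ... | yes _   = irrefl refl
      ... | no  x≮y = x≮y

      _<₂_ : K × K → K × K → Set ℓ
      _<₂_ = ×-Lex _≡_ _<_ _<_

      _<₃_ : K × K × K → K × K × K → Set ℓ
      _<₃_ = ×-Lex _≡_ _<_ _<₂_

      rank : X × X → K × K × K
      rank p = to v (max p) , to v (proj₁ p) , to v (proj₂ p)

      _⊏_ : X × X → X × X → Set ℓ
      p ⊏ q = rank p <₃ rank q

      ⊏-wellFounded : WellFounded _⊏_
      ⊏-wellFounded = On.wellFounded rank
        (×-wellFounded {_<₂_ = _<₂_} wellFounded (×-wellFounded {_<₂_ = _<_} wellFounded wellFounded))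

      ⊏-connex : ∀ p q → p ≢ q → p ⊏ q ⊎ q ⊏ p
      ⊏-connex p@(x , y) q@(x′ , y′) p≢q with compare (to v (max p)) (to v (max q))
      ... | tri< lt _ _ = inj₁ (inj₁ lt)
      ... | tri> _ _ gt = inj₂ (inj₁ gt)
      ... | tri≈ _ eq _ with compare (to v x) (to v x′)
      ...   | tri< lt _ _  = inj₁ (inj₂ (eq , inj₁ lt))
      ...   | tri> _ _ gt  = inj₂ (inj₂ (sym eq , inj₁ gt))
      ...   | tri≈ _ eq₁ _ with compare (to v y) (to v y′)
      ...     | tri< lt _ _  = inj₁ (inj₂ (eq , inj₂ (eq₁ , lt)))
      ...     | tri> _ _ gt  = inj₂ (inj₂ (sym eq , inj₂ (sym eq₁ , gt)))
      ...     | tri≈ _ eq₂ _ = contradiction (cong₂ _,_ (injective v eq₁) (injective v eq₂)) p≢q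

      max-mono : ∀ {p q} → p ⊏ q → ¬ to v (max q) < to v (max p)
      max-mono (inj₁ lt)       gt = irrefl refl (<-trans lt gt)
      max-mono (inj₂ (eq , _)) gt = irrefl (sym eq) gt

      below : ∀ p q → q ⊏ p → ClosedSquare (to v (max p))
      below p q q⊏p =
        closedSegment _ (to v (proj₁ q)) (≮-trans (≤maxˡ q) (max-mono q⊏p)) ,
        closedSegment _ (to v (proj₂ q)) (≮-trans (≤maxʳ q) (max-mono q⊏p))

      below-injective : ∀ p {q r} q⊏p r⊏p → below p q q⊏p ≡ below p r r⊏p → q ≡ r
      below-injective p _ _ eq = cong₂ _,_
        (injective v (closedSegment-injective _ _ _ (,-injectiveˡ eq)))
        (injective v (closedSegment-injective _ _ _ (,-injectiveʳ eq)))

      pick : 𝒫 X → X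
      pick U with em {P = ∃[ x ] x ∉ U}
      ... | yes (x , _) = x
      ... | no  _       = to inf 0

      pick∉ : ∀ U → ∃[ x ] x ∉ U → pick U ∉ U
      pick∉ U ∃x with em {P = ∃[ x ] x ∉ U}
      ... | yes (_ , x∉U) = x∉U
      ... | no  ∄x        = contradiction ∃x ∄x

      Used : ∀ p → (∀ {q} → q ⊏ p → X) → X → Set ℓ
      Used p g y = ∃[ q ] Σ[ q⊏p ∈ q ⊏ p ] g q⊏p ≡ y

      used : ∀ p → (∀ {q} → q ⊏ p → X) → 𝒫 X
      used p g = setOf (Used p g)

      -- Unfolding the recursion requires `step` to respect pointwise equality. It sees the earlier
      -- values only through the set of them, so extensionality of subsets suffices.
      used-cong : ∀ p {g h : ∀ {q} → q ⊏ p → X} →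
        (∀ {q} (q⊏p : q ⊏ p) → g q⊏p ≡ h q⊏p) → used p g ≡ used p h
      used-cong p g≗h = 𝒫-ext λ y → does-⇔ (mk⇔
        (λ (q , q⊏p , eq) → q , q⊏p , trans (sym (g≗h q⊏p)) eq)
        (λ (q , q⊏p , eq) → q , q⊏p , trans (g≗h q⊏p) eq)) em em

      step : ∀ p → (∀ {q} → q ⊏ p → X) → X
      step p g = pick (used p g)

      g : X × X → X
      g = All.wfRec ⊏-wellFounded ℓ (λ _ → X) step

      g-unfold : ∀ p → g p ≡ step p (λ {q} _ → g q)
      g-unfold p = FixPoint.unfold-wfRec ⊏-wellFounded (λ _ → X) step
        (λ p eq → cong pick (used-cong p eq))

      -- If all of `X` were used, choosing for each value a pair below `p` that takes it would embed
      -- `X` in the closed square, against `small`.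
      unused : ∀ p → ∃[ x ] x ∉ used p (λ {q} _ → g q)
      unused p = ¬∀⇒∃¬′ λ all → small (max p) (mk↣
        {to = λ x → let q , q⊏p , _ = ∈⁻ (Used p λ {q} _ → g q) (all x) in below p q q⊏p}
        λ {x} {y} eq →
          let _ , q⊏p , gq≡x = ∈⁻ (Used p λ {q} _ → g q) (all x)
              _ , r⊏p , gr≡y = ∈⁻ (Used p λ {q} _ → g q) (all y)
          in trans (sym gq≡x) (trans (cong g (below-injective p q⊏p r⊏p eq)) gr≡y))
        where
        ¬∀⇒∃¬′ : {A : 𝒫 X} → ¬ (∀ x → x ∈ A) → ∃[ x ] x ∉ A
        ¬∀⇒∃¬′ ¬∀ = dne λ ¬∃ → ¬∀ λ x → decidable-stable (T? _) λ x∉A → ¬∃ (x , x∉A)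

      g-⊏ : ∀ {p q} → q ⊏ p → g q ≢ g p
      g-⊏ {p} {q} q⊏p eq = subst (_∉ used p (λ {q} _ → g q)) (sym (g-unfold p))
        (pick∉ _ (unused p)) (∈⁺ (Used p λ {q} _ → g q) (q , q⊏p , eq))

      square : (X × X) ↣ X
      square = mk↣ {to = g} λ {p} {q} eq → dne λ p≢q → distinct eq (⊏-connex p q p≢q)
        where
        distinct : ∀ {p q} → g p ≡ g q → ¬ (p ⊏ q ⊎ q ⊏ p)
        distinct eq (inj₁ p⊏q) = g-⊏ p⊏q eq
        distinct eq (inj₂ q⊏p) = g-⊏ q⊏p (sym eq)

    Squarable : Set ℓ → Set ℓ
    Squarable X = Infinite X → (X × X) ↣ X

    -- An infinite squarable segment absorbs its closed square, so `X` would embed in the segment. A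
    -- finite segment has a finite closed square.
    closedSquare-small : ∀ {X : Set ℓ} {k} → Infinite X → Squarable (Segment k) →
      ¬ (X ↣ Segment k) → ¬ (X ↣ ClosedSquare k)
    closedSquare-small {X} {k} inf sq X↣̸k X↣ with em {P = Infinite (Segment k)}
    ... | yes segInf =
      let pair = sq segInf
          m = Maybe↣ (infinite⇒distinct segInf) pair
      in X↣̸k (pair ↣-∘ (×-map↣ m m ↣-∘ X↣))
    ... | no segFin =
      let xs , x∈xs = finite⇒listable segFin
          ys = nothing ∷ map just xs
          y∈ys : ∀ y → y ∈ₗ ys
          y∈ys = λ { nothing → here refl ; (just x) → there (∈-map⁺ just (x∈xs x)) }
      in no-injection-into-list (X↣ ↣-∘ inf) (cartesianProduct ys ys)
           λ n → ∈-cartesianProduct⁺ (y∈ys _) (y∈ys _)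

    segment-squarable : ∀ k → Squarable (Segment k)
    segment-squarable = All.wfRec wellFounded ℓ (λ k → Squarable (Segment k)) step
      where
      step : ∀ k → (∀ {j} → j < k → Squarable (Segment j)) → Squarable (Segment k)
      step k ih inf with em {P = ∃[ j ] j < k × (Segment k ↣ Segment j)}
      -- The segment embeds in an earlier one, whose square is handled by induction.
      ... | yes (j , j<k , f) = Segment-mono j<k ↣-∘ (ih j<k (f ↣-∘ inf) ↣-∘ ×-map↣ f f)
      -- Now `k` behaves like an initial ordinal, so the Gödel order applies.
      ... | no  isInitial = GödelOrder.square (mk↣ {to = proj₁} El-≡) inf λ (j , j<k) →
        closedSquare-small inf (ih (∈↓⁻ j<k)) λ f → isInitial (j , ∈↓⁻ j<k , f)

    carrier-small : ∀ k → ¬ (K ↣ ClosedSquare k)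
    carrier-small k =
      closedSquare-small infinite (segment-squarable k) (proj₂ (initial k))

    -- Abstract, so that the unfolding of the recursion stays out of unification.

    abstract
      pair : (K × K) ↣ K
      pair = GödelOrder.square (↣-id K) infinite carrier-small

      code : List K ↣ K
      code = List↣ (infinite⇒distinct infinite) pair

    -- A greatest element `k` would make the whole cardinal a closed segment, hence embed it in
    -- `ClosedSquare k`.
    limit : ∀ k → ∃[ i ] k < i
    limit k = dne λ isMax → carrier-small k (mk↣
      {to = λ x → closedSegment k x (λ k<x → isMax (x , k<x)) , nothing}
      λ eq → closedSegment-injective k _ _ (,-injectiveˡ eq))

    -- Families with finite traces

    IsTrace : 𝒫 (𝒫 K) → K → 𝒫 K → Set ℓ
    IsTrace Ξ i B = ∃[ A ] A ∈ Ξ × A ∩ ↓ i ≡ B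

    Trace : 𝒫 (𝒫 K) → K → Set ℓ
    Trace Ξ i = El (image em (_∩ ↓ i) Ξ)

    trace : ∀ Ξ i → El Ξ → Trace Ξ i
    trace Ξ i (A , A∈Ξ) = A ∩ ↓ i , ∈⁺ (IsTrace Ξ i) (A , A∈Ξ , refl)

    trace-agree : ∀ {i k} {A B : 𝒫 K} → A ∩ ↓ i ≡ B ∩ ↓ i → k < i → A k ≡ B k
    trace-agree {i} {k} {A} {B} eq k<i = trans (sym (restrict A)) (trans (cong-app eq k) (restrict B))
      where
      restrict : ∀ C → (C ∩ ↓ i) k ≡ C k
      restrict C rewrite dec-true (k <? i) k<i = ∧-identityʳ (C k)

    SequencesBounded : Set ℓ
    SequencesBounded = (d : ℕ → K) → ∃[ j ] ∀ n → d n < j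

    -- The range of an unbounded sequence is an unbounded set, so `C` embeds in it; but the range
    -- embeds in ℕ.
    uncountable⇒bounded : UncountableCofinality → SequencesBounded
    uncountable⇒bounded (C , (_ , least) , _ , C↣̸ℕ) d = dne λ unbounded →
      C↣̸ℕ (mk↣ {to = position} (λ {x} {y} → position-injective x y) ↣-∘
        least (setOf InRange) λ (j , bound) → unbounded (j , λ n → bound (d n) (∈⁺ InRange (n , refl))))
      where
      InRange : K → Set ℓ
      InRange x = ∃[ n ] d n ≡ x

      position : El (setOf InRange) → ℕ
      position (x , p) = proj₁ (∈⁻ InRange p)

      position-injective : ∀ x y → position x ≡ position y → x ≡ y
      position-injective (x , p) (y , q) eq = El-≡
        (trans (sym (proj₂ (∈⁻ InRange p))) (trans (cong d eq) (proj₂ (∈⁻ InRange q))))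

    module _ (Ξ : 𝒫 (𝒫 K)) (finite-trace : ∀ k → ∃[ i ] k < i × ¬ Infinite (Trace Ξ i)) where

      -- Infinitely many sets would give countably many points telling them apart pairwise. Bounding
      -- these row by row, then bounding the row bounds, puts all of them below one `i` with
      -- finitely many traces.
      bounded⇒finite : SequencesBounded → ¬ Infinite (El Ξ)
      bounded⇒finite bounded f = finite (mk↣ {to = trace Ξ i ∘ to f} λ {m} {n} eq →
        trace-injective m n (cong proj₁ eq))
        where
        A : ℕ → 𝒫 K
        A n = proj₁ (to f n)

        difference : ∀ m n → ∃[ k ] (m ≢ n → A m k ≢ A n k)
        difference m n with em {P = A m ≡ A n}
        -- Equal sets force `m ≡ n`, so any point will do.
        ... | yes eq = to infinite 0 , λ m≢n → contradiction (injective f (El-≡ eq)) m≢n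
        ... | no A≢ = let k , ≢ = separate A≢ in k , λ _ → ≢

        row : ∀ m → ∃[ j ] ∀ n → proj₁ (difference m n) < j
        row m = bounded λ n → proj₁ (difference m n)

        rows : ∃[ j ] ∀ m → proj₁ (row m) < j
        rows = bounded (proj₁ ∘ row)

        i : K
        i = proj₁ (finite-trace (proj₁ rows))

        rows<i : proj₁ rows < i
        rows<i = proj₁ (proj₂ (finite-trace (proj₁ rows)))

        finite : ¬ Infinite (Trace Ξ i)
        finite = proj₂ (proj₂ (finite-trace (proj₁ rows)))

        trace-injective : ∀ m n → A m ∩ ↓ i ≡ A n ∩ ↓ i → m ≡ n
        trace-injective m n eq = decidable-stable (m ≟ℕ n) λ m≢n →
          proj₂ (difference m n) m≢n
            (trace-agree eq (<-trans (proj₂ (row m) n) (<-trans (proj₂ rows m) rows<i)))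

      -- Each trace at a level above `d n` has a number. As `d` is cofinal, every `k` lies below
      -- some level, so the sequence of numbers determines the set.
      unbounded⇒↣𝒫ℕ : ¬ SequencesBounded → El Ξ ↣ 𝒫 ℕ
      unbounded⇒↣𝒫ℕ unbounded with d , cofinal ← ¬∀⇒∃¬ unbounded =
        mk↣ {to = λ A → graph (trace-index A)} λ {A} {B} eq → El-≡ (𝒫-ext λ k →
          let n , dn≮k = ¬∀⇒∃¬ℕ λ all → cofinal (k , all)
          in agree A B k n dn≮k (cong proj₁ (injective (enum n)
               (graph-injective (trace-index A) (trace-index B) eq n))))
        where
        ¬∀⇒∃¬ℕ : {P : ℕ → Set ℓ} → ¬ (∀ n → P n) → ∃[ n ] ¬ P n
        ¬∀⇒∃¬ℕ ¬∀ = dne λ ¬∃ → ¬∀ λ n → dne λ ¬p → ¬∃ (n , ¬p)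

        level : ∀ n → ∃[ i ] d n < i × ¬ Infinite (Trace Ξ i)
        level n = finite-trace (d n)

        enum : ∀ n → Trace Ξ (proj₁ (level n)) ↣ ℕ
        enum n = listable⇒↣ℕ (finite⇒listable (proj₂ (proj₂ (level n))))

        trace-index : El Ξ → ℕ → ℕ
        trace-index A n = to (enum n) (trace Ξ (proj₁ (level n)) A)

        agree : ∀ (A B : El Ξ) k n → ¬ d n < k →
          proj₁ A ∩ ↓ (proj₁ (level n)) ≡ proj₁ B ∩ ↓ (proj₁ (level n)) → proj₁ A k ≡ proj₁ B k
        agree A B k n dn≮k eq = trace-agree {A = proj₁ A} {B = proj₁ B} eq
          (≮-<-trans dn≮k (proj₁ (proj₂ (level n))))

      -- The split is on boundedness of sequences: an unbounded one refutes the first alternative of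
      -- `A1`, which leaves the second.
      finite-traces⇒↣ : UncountableCofinality ⊎ 𝒫 ℕ ≺ K → El Ξ ↣ K
      finite-traces⇒↣ A1 with em {P = SequencesBounded} | A1
      ... | yes bounded  | _ = infinite ↣-∘ listable⇒↣ℕ (finite⇒listable (bounded⇒finite bounded))
      ... | no unbounded | inj₁ cof = contradiction (uncountable⇒bounded cof) unbounded
      ... | no unbounded | inj₂ (𝒫ℕ↣K , _) = 𝒫ℕ↣K ↣-∘ unbounded⇒↣𝒫ℕ unbounded

    -- The filter generated by a regular family

    decode : K → List K
    decode x with em {P = ∃[ xs ] to code xs ≡ x}
    ... | yes (xs , _) = xs
    -- Points that code no list count as the empty set.
    ... | no _         = []

    decode-code : ∀ xs → decode (to code xs) ≡ xs
    decode-code xs with em {P = ∃[ ys ] to code ys ≡ to code xs}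
    ... | yes (_ , eq) = injective code eq
    ... | no ∄         = contradiction (xs , refl) ∄

    -- The points extending `xs` form a basic set of the filter, the intersection of `generator a`
    -- over `a` in `xs`.
    Extends : List K → K → Set ℓ
    Extends xs x = ∀ {a} → a ∈ₗ xs → a ∈ₗ decode x

    code-extends : ∀ {xs ys} → (∀ {a} → a ∈ₗ xs → a ∈ₗ ys) → Extends xs (to code ys)
    code-extends {ys = ys} xs⊆ys a∈xs = subst (_ ∈ₗ_) (sym (decode-code ys)) (xs⊆ys a∈xs)

    Large : 𝒫 K → Set ℓ
    Large A = ∃[ xs ] ∀ {x} → Extends xs x → x ∈ A

    D : Filter K
    D = record
      { sets     = setOf Large
      ; full∈    = ∈⁺ Large ([] , λ _ → _)
      ; ∅∉       = λ ∅∈ → let xs , sub = ∈⁻ Large ∅∈ in sub (code-extends id)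
      ; ∩-closed = λ A∈ B∈ →
          let xs , xs⊆A = ∈⁻ Large A∈
              ys , ys⊆B = ∈⁻ Large B∈
          in ∈⁺ Large (xs ++ ys , λ ext →
               Equivalence.from T-∧ (xs⊆A (ext ∘ ∈-++⁺ˡ) , ys⊆B (ext ∘ ∈-++⁺ʳ xs)))
      ; ⊆-closed = λ A∈ A⊆B → let xs , xs⊆A = ∈⁻ Large A∈ in ∈⁺ Large (xs , λ ext → A⊆B (xs⊆A ext))
      }

    generator : K → 𝒫 K
    generator a = setOf λ x → a ∈ₗ decode x

    generator⁻ : ∀ {a x} → x ∈ generator a → a ∈ₗ decode x
    generator⁻ {a} = ∈⁻ λ x → a ∈ₗ decode x

    generator⁺ : ∀ {a x} → a ∈ₗ decode x → x ∈ generator a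
    generator⁺ {a} = ∈⁺ λ x → a ∈ₗ decode x

    -- The point coding the singleton of `a` lies in `generator b` only if `b` is `a`.
    generator-injective : ∀ {a b} → generator a ≡ generator b → a ≡ b
    generator-injective {a} {b} eq
      with here b≡a ← subst (b ∈ₗ_) (decode-code (a ∷ []))
        (generator⁻ (subst (to code (a ∷ []) ∈_) eq (generator⁺ (code-extends id (here refl)))))
      = sym b≡a

    -- Finitely many generators share the code of the list of their labels. A point `x` lies only in
    -- generators with label in the finite list `decode x`.
    D-regular : Regular K D
    D-regular = setOf IsGenerator , ⊆D , (fip , no-infinite) , ⤖K
      where
      IsGenerator : 𝒫 K → Set ℓ
      IsGenerator A = ∃[ a ] generator a ≡ A

      ⊆D : setOf IsGenerator ⊆ sets D
      ⊆D A∈ with a , refl ← ∈⁻ IsGenerator A∈ =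
        ∈⁺ Large (a ∷ [] , λ ext → generator⁺ (ext (here refl)))

      labels : (As : List (𝒫 K)) → All (_∈ setOf IsGenerator) As →
        ∃[ xs ] ∀ {x} → Extends xs x → All (x ∈_) As
      labels [] [] = [] , λ _ → []
      labels (A ∷ As) (A∈ ∷ As∈)
        with a , refl ← ∈⁻ IsGenerator A∈ | xs , ok ← labels As As∈ =
        a ∷ xs , λ ext → generator⁺ (ext (here refl)) ∷ ok (ext ∘ there)

      fip : (As : List (𝒫 K)) → All (_∈ setOf IsGenerator) As → ∃[ x ] All (x ∈_) As
      fip As As∈ = let xs , ok = labels As As∈ in to code xs , ok (code-extends id)

      no-infinite : ∀ S → S ⊆ setOf IsGenerator → Infinite (El S) → ¬ (∃[ x ] ∀ A → A ∈ S → x ∈ A)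
      no-infinite S S⊆ f (x , x∈S) = no-injection-into-list (mk↣ {to = label ∘ to f} λ eq →
          injective f (El-≡ (trans (sym (label-≡ (to f _)))
            (trans (cong generator eq) (label-≡ (to f _))))))
        (decode x) λ n → generator⁻ (subst (x ∈_) (sym (label-≡ (to f n))) (x∈S _ (proj₂ (to f n))))
        where
        label : El S → K
        label (A , A∈) = proj₁ (∈⁻ IsGenerator (S⊆ A∈))

        label-≡ : ∀ A → generator (label A) ≡ proj₁ A
        label-≡ (A , A∈) = proj₂ (∈⁻ IsGenerator (S⊆ A∈))

      ⤖K : El (setOf IsGenerator) ⤖ K
      ⤖K = mk⤖ {to = label} ((λ {x} {y} → label-injective x y) , λ a →
          (generator a , ∈⁺ IsGenerator (a , refl)) ,
          λ { refl → generator-injective (proj₂ (∈⁻ IsGenerator {generator a} _)) })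
        where
        label : El (setOf IsGenerator) → K
        label (A , A∈) = proj₁ (∈⁻ IsGenerator A∈)

        label-injective : ∀ x y → label x ≡ label y → x ≡ y
        label-injective (A , A∈) (B , B∈) eq = El-≡ (trans (sym (proj₂ (∈⁻ IsGenerator A∈)))
          (trans (cong generator eq) (proj₂ (∈⁻ IsGenerator B∈))))

    -- Failure of double regularity

    -- A regular family reindexed by λ, with empty infinite intersections restated as
    -- point-finiteness.
    record RegularSystem {X : Set ℓ} (F : Filter X) : Set ℓ where
      field
        member       : K → 𝒫 X
        member∈      : ∀ a → member a ∈ sets F
        point-finite : ∀ y → ¬ Infinite (El λ a → member a y)

    regular⇒system : {X : Set ℓ} {F : Filter X} → Regular K F → RegularSystem F
    regular⇒system {X} {F} (E , E⊆F , (_ , no-infinite) , E⤖K) = record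
      { member       = λ a → proj₁ (to e a)
      ; member∈      = λ a → E⊆F (proj₂ (to e a))
      ; point-finite = λ y f → no-infinite (λ A → E A ∧ A y)
          (proj₁ ∘ Equivalence.to T-∧)
          (mk↣ {to = λ n → let a , y∈ = to f n in
              proj₁ (to e a) , Equivalence.from T-∧ (proj₂ (to e a) , y∈)}
            λ eq → injective f (El-≡ (injective e (El-≡ (cong proj₁ eq)))))
          (y , λ A A∈ → proj₂ (Equivalence.to T-∧ A∈))
      }
      where
      e : K ↣ El E
      e = ↔⇒↣ (↔-sym (⤖⇒↔ E⤖K))

    module _ (A1 : UncountableCofinality ⊎ 𝒫 ℕ ≺ K) (𝒜 : 𝒫 (𝒫 K)) (𝒜⤖ : El 𝒜 ⤖ 𝒫 K)
      (trace↣ : ∀ i → Trace 𝒜 i ↣ K) (dr : DoublyRegular κ D) where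

      open DoublyRegular dr
      module F i = RegularSystem (regular⇒system {F = F i} (F-regular i))

      -- Quantifying over all `i` admits the points outside every `u i`. For other points,
      -- disjointness leaves a single condition.
      InC : El 𝒜 → K → Set ℓ
      InC A x = ∀ i (x∈uᵢ : x ∈ u i) → (x , x∈uᵢ) ∈ F.member i (to (trace↣ i) (trace 𝒜 i A))

      C : El 𝒜 → 𝒫 K
      C A = setOf (InC A)

      C∈D : ∀ A → C A ∈ sets D
      -- The exceptional set is empty, so any point bounds it.
      C∈D A = contains (C A) (∅ , (to infinite 0 , λ _ ()) , λ i _ →
        Filter.⊆-closed (F i) (F.member∈ i _) λ {(x , x∈uᵢ)} x∈ →
          ∈⁺ (InC A) (at i x x∈uᵢ x∈))
        where
        at : ∀ i x (x∈uᵢ : x ∈ u i) → (x , x∈uᵢ) ∈ F.member i (to (trace↣ i) (trace 𝒜 i A)) →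
          ∀ j (x∈uⱼ : x ∈ u j) → (x , x∈uⱼ) ∈ F.member j (to (trace↣ j) (trace 𝒜 j A))
        at i x x∈uᵢ x∈ j x∈uⱼ with em {P = i ≡ j}
        ... | yes refl =
          subst (λ p → (x , p) ∈ F.member i (to (trace↣ i) (trace 𝒜 i A))) (T-irrelevant _ _) x∈
        ... | no i≢j = contradiction (x∈uᵢ , x∈uⱼ) (disjoint i j i≢j x)

      Meets : List K → K → Set ℓ
      Meets xs i = ∃[ x ] Extends xs x × x ∈ u i

      -- Otherwise the complement of the basic set contains `u i` for all `i` beyond `k`, so it lies
      -- in the filter and includes a basic set itself.
      meets-unbounded : ∀ xs k → ∃[ i ] k < i × Meets xs i
      meets-unbounded xs k = dne λ none →
        let
          -- The exceptional indices are at most `k`, and `Bounded` asks for a strict bound.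
          j , k<j = limit k

          avoiding : 𝒫 K
          avoiding = setOf λ x → ¬ Extends xs x

          avoids : Large avoiding
          avoids = ∈⁻ Large (contains avoiding (setOf (Meets xs)
            , (j , λ i i∈ → ≮-<-trans (λ k<i → none (i , k<i , ∈⁻ (Meets xs) i∈)) k<j)
            , λ i i∉ → Filter.⊆-closed (F i) (Filter.full∈ (F i)) λ {(x , x∈uᵢ)} _ →
                ∈⁺ (λ x → ¬ Extends xs x) λ ext → i∉ (∈⁺ (Meets xs) (x , ext , x∈uᵢ))))

          ys , ys⊆ = avoids
        -- The point `code (xs ++ ys)` lies in both basic sets.
        in ∈⁻ (λ x → ¬ Extends xs x) (ys⊆ (code-extends (∈-++⁺ʳ xs))) (code-extends ∈-++⁺ˡ)

      InΞ : List K → 𝒫 K → Set ℓ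
      InΞ xs A = Σ[ A∈𝒜 ∈ A ∈ 𝒜 ] (∀ {x} → Extends xs x → x ∈ C (A , A∈𝒜))

      Ξ : List K → 𝒫 (𝒫 K)
      Ξ xs = setOf (InΞ xs)

      -- One point `x` of `u i` lies in `C A` for every `A` in `Ξ xs`. So the codes of the traces
      -- index members through `x`, and there are finitely many of those.
      trace-finite : ∀ xs i → Meets xs i → ¬ Infinite (Trace (Ξ xs) i)
      trace-finite xs i (x , ext , x∈uᵢ) f =
        F.point-finite i (x , x∈uᵢ) (mk↣ {to = label} (λ {B} {B′} → label-injective B B′) ↣-∘ f)
        where
        inherit : (B : Trace (Ξ xs) i) → Σ[ A ∈ El 𝒜 ] proj₁ A ∩ ↓ i ≡ proj₁ B × x ∈ C A
        inherit (B , B∈)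
          with A , A∈Ξ , eq ← ∈⁻ (IsTrace (Ξ xs) i) B∈
          with A∈𝒜 , ⊆C ← ∈⁻ (InΞ xs) A∈Ξ = (A , A∈𝒜) , eq , ⊆C ext

        label : Trace (Ξ xs) i → El (λ a → F.member i a (x , x∈uᵢ))
        label B = let A , _ , x∈C = inherit B in
          to (trace↣ i) (trace 𝒜 i A) , ∈⁻ (InC A) x∈C i x∈uᵢ

        label-injective : ∀ B B′ → label B ≡ label B′ → B ≡ B′
        label-injective B B′ eq =
          let _ , A≡B , _ = inherit B
              _ , A′≡B′ , _ = inherit B′
          in El-≡ (trans (sym A≡B) (trans (cong proj₁ (injective (trace↣ i) (cong proj₁ eq))) A′≡B′))

      Ξ↣K : ∀ xs → El (Ξ xs) ↣ K
      Ξ↣K xs = finite-traces⇒↣ (Ξ xs) (λ k →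
        let i , k<i , meets = meets-unbounded xs k in i , k<i , trace-finite xs i meets) A1

      -- This is λ · λ = λ: the first coordinate names a basic set included in `C A`, the second the
      -- place of `A` among the sets sharing it.
      𝒜↣K : El 𝒜 ↣ K
      𝒜↣K = mk↣
        {to = λ A → to pair (to code (support A) , to (Ξ↣K (support A)) (inΞ A))} λ {A} {B} eq →
        let eq′ = injective pair eq in
        El-≡ (fibre (inΞ A) (inΞ B) (injective code (,-injectiveˡ eq′)) (,-injectiveʳ eq′))
        where
        support : El 𝒜 → List K
        support A = proj₁ (∈⁻ Large (C∈D A))

        inΞ : ∀ A → El (Ξ (support A))
        inΞ A = proj₁ A , ∈⁺ (InΞ (support A)) (proj₂ A , proj₂ (∈⁻ Large (C∈D A)))

        fibre : ∀ {xs ys} (A : El (Ξ xs)) (B : El (Ξ ys)) → xs ≡ ys →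
          to (Ξ↣K xs) A ≡ to (Ξ↣K ys) B → proj₁ A ≡ proj₁ B
        fibre {xs} A B refl eq = cong proj₁ (injective (Ξ↣K xs) eq)

      not-doubly-regular : ⊥
      not-doubly-regular = cantor (𝒜↣K ↣-∘ ↔⇒↣ (↔-sym (⤖⇒↔ 𝒜⤖)))

theorem8 : {ℓ : Level} (em : ExcludedMiddle ℓ) (ext : Extensionality ℓ ℓ) →
    (κ : InfiniteCardinal ℓ) (let open InfiniteCardinal κ) →
    (UncountableCofinality ⊎ 𝒫 ℕ ≺ Carrier) →
    (∃[ 𝒜 ] (El 𝒜 ⤖ 𝒫 Carrier) × (∀ i → El (image em (_∩ ↓ i) 𝒜) ↣ Carrier)) →
    Σ[ D ∈ Filter Carrier ] Regular Carrier D × ¬ DoublyRegular κ D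
theorem8 em ext κ A1 (𝒜 , 𝒜⤖ , trace↣) = D , D-regular , not-doubly-regular A1 𝒜 𝒜⤖ trace↣
  where open Classical.Cardinal em ext κ
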